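{- Let $K^0 \subseteq K^1 \subseteq \cdots \subseteq K^m = \mathcal{K}$ be a filtration of a simplicial complex $\mathcal{K}$ (over a finite vertex set). For every pair of indices $0\leq k \leq l \leq m$ and every dimension $n$, the $l$-persistent $n$-th Betti number $\beta_n^{k,l}$ of $K^k$ satisfies $$\beta_n^{k,l} = \sum_{0\leq i \leq k}\ \sum_{l<j\leq m} \mu_n^{i,j} + \beta_n^{k,m}.$$
   Context: Let $V$ be a finite ordered vertex set. A simplex over $V$ is a finite subset of $V$; an $n$-simplex is a simplex of cardinality $n+1$. A simplicial complex over $V$ is a set of simplices over $V$ closed under taking subsets. A filtration of $\mathcal{K}$ is a nested sequence of simplicial complexes $K^0\subseteq K^1\subseteq\cdots\subseteq K^m=\mathcal{K}$. For a simplicial complex $K$, $C_n(K)$ is the free $\mathbb{Z}_2$-module (vector space) on the $n$-simplices of $K$, and the differential $d_n : C_n(K)\to C_{n-1}(K)$ is the linear map sending an $n$-simplex $(v_0,\ldots,v_n)$ to $\sum_{i=0}^n (v_0,\ldots,v_{i-1},v_{i+1},\ldots,v_n)$. Put $Z_n(K)=\ker d_n$ and $B_n(K)=\operatorname{im} d_{n+1}$. For a filtration write $Z_n^j=Z_n(K^j)$, $B_n^j=B_n(K^j)$, and for $0\le j\le p\le m$ let $i_n^{j,p}: C_n(K^j)\to C_n(K^p)$ be the linear map induced by the inclusion of the $n$-simplices of $K^j$ into those of $K^p$ (the identity if $j=p$). The $p$-persistent $n$-th homology group of $K^j$ is $H_n^{j,p}=i_n^{j,p}(Z_n^j)/\bigl(B_n^p\cap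 i_n^{j,p}(Z_n^j)\bigr)$, and the $p$-persistent $n$-th Betti number of $K^j$ is $\beta_n^{j,p}=\dim_{\mathbb{Z}_2} H_n^{j,p}$. By convention $\beta_n^{ -1,p}=0$. For $0\le j<p\le m$, the integer $\mu_n^{j,p}$ is defined by $$\mu_n^{j,p} = (\beta_n^{j,p-1} - \beta_n^{j,p}) - (\beta_n^{j-1,p-1} - \beta_n^{j-1,p}).$$ -}

module Defs where

open import Algebra.Bundles using (CommutativeMonoid; CommutativeRing)
open import Algebra.Module.Bundles using (LeftModule)
open import Algebra.Module.Morphism.Structures using (module LeftModuleMorphisms)
import Algebra.Properties.AbelianGroup as AbelianGroupProperties
import Algebra.Properties.CommutativeMonoid.Sum as FiniteSum
import Algebra.Properties.CommutativeSemigroup as CommutativeSemigroupProperties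
open import Data.Bool.Base using (Bool; true; false; _xor_; _∧_)
import Data.Bool.Properties as Bool
open import Data.Fin.Base using (Fin; zero; suc; toℕ; fromℕ; inject₁; combine; funToFin; finToFun)
  renaming (_≤_ to _≤ᶠ_; _<_ to _<ᶠ_)
import Data.Fin.Properties as Fin
import Data.Fin.Subset as Subset
open Subset using (Subset; ∣_∣) renaming (_∈_ to _∈ˢ_; _⊆_ to _⊆ˢ_; _-_ to _∖_)
open import Data.Fin.Subset.Properties using (p─q⊆p; p─⊥≡p) renaming (_∈?_ to _∈ˢ?_)
open import Data.Integer.Base as ℤ using (ℤ; +_; 1ℤ)
import Data.Integer.Properties as ℤ
open import Data.List.Base using (List; []; _∷_; foldr; map; cartesianProductWith)
open import Data.List.Membership.Propositional using (_∈_)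
open import Data.List.Membership.Propositional.Properties using (∈-cartesianProductWith⁺)
open import Data.List.Relation.Unary.All as All using (All; []; _∷_)
open import Data.List.Relation.Unary.AllPairs as AllPairs using (AllPairs; []; _∷_)
import Data.List.Relation.Unary.AllPairs.Properties as AllPairs
open import Data.List.Relation.Unary.Any as Any using (Any; here; there; any?)
import Data.List.Relation.Unary.Any.Properties as Any
open import Data.List.Relation.Unary.Unique.Propositional using (Unique)
import Data.List.Relation.Unary.Unique.Propositional.Properties as Unique
open import Data.Nat.Base as ℕ using (ℕ; zero; suc; s≤s)
import Data.Nat.Properties as ℕ
open import Data.Product.Base using (Σ; ∃; _×_; _,_; proj₁; proj₂)
open import Data.Unit.Base using (⊤; tt)
open import Data.Vec.Base using ([]; _∷_; here; there)
import Data.Vec.Properties as Vec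
open import Data.Vec.Functional as Vector using (Vector)
open import Function.Base using (id; _∘_; const)
open import Function.Bundles using (Inverse)
open import Level using (0ℓ)
open import Relation.Binary.Definitions using (DecidableEquality) renaming (Decidable to Decidable₂)
open import Relation.Binary.PropositionalEquality
  using (_≡_; _≢_; refl; sym; trans; cong; cong₂; subst)
import Relation.Binary.Reasoning.Setoid as ≈-Reasoning
open import Relation.Nullary using (Dec; yes; no; ¬_; does; contradiction; _×-dec_)
import Relation.Nullary.Decidable as Dec
open import Relation.Unary using (Pred; Decidable; _⊆_; _≐_)

module _ {a ℓ} (M : CommutativeMonoid a ℓ) where

  open CommutativeMonoid M using (Carrier; ε)

  when : ∀ {p} {P : Set p} → Dec P → (P → Carrier) → Carrier
  when (yes p) f = f p
  when (no  _) f = ε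

  ∑where : ∀ {n p} {P : Pred (Fin n) p} →
           Decidable P → (∀ i → P i → Carrier) → Carrier
  ∑where P? f = FiniteSum.sum M (λ i → when (P? i) (f i))

ℤ₂ : CommutativeRing 0ℓ 0ℓ
ℤ₂ = Bool.xor-∧-commutativeRing

module ℤ₂ = CommutativeRing ℤ₂

VectorSpace : Set₁
VectorSpace = LeftModule ℤ₂.ring 0ℓ 0ℓ

module VectorSpaceProperties (V : VectorSpace) where

  open LeftModule V public
  open FiniteSum +ᴹ-commutativeMonoid public using (sum; sum-syntax; sum-cong-≋; ∑-distrib-+)
  open AbelianGroupProperties +ᴹ-abelianGroup public using (⁻¹-∙-comm; ε⁻¹≈ε)
  open CommutativeSemigroupProperties
    (CommutativeMonoid.commutativeSemigroup +ᴹ-commutativeMonoid) public using (interchange)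
  open ≈-Reasoning ≈ᴹ-setoid public

  x+x≈0 : ∀ x → x +ᴹ x ≈ᴹ 0ᴹ
  x+x≈0 x = begin
    x +ᴹ x                    ≈⟨ +ᴹ-cong (*ₗ-identityˡ x) (*ₗ-identityˡ x) ⟨
    true *ₗ x +ᴹ true *ₗ x    ≈⟨ *ₗ-distribʳ x true true ⟨
    false *ₗ x                ≈⟨ *ₗ-zeroˡ x ⟩
    0ᴹ                        ∎

  -x≈x : ∀ x → -ᴹ x ≈ᴹ x
  -x≈x x = ≈ᴹ-sym (uniqueʳ‿-ᴹ x x (x+x≈0 x))

  x≈y⇒x-y≈0 : ∀ {x y} → x ≈ᴹ y → x +ᴹ -ᴹ y ≈ᴹ 0ᴹ
  x≈y⇒x-y≈0 {x} {y} x≈y = ≈ᴹ-trans (+ᴹ-congʳ x≈y) (-ᴹ‿inverseʳ y)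

record LinearMap (V W : VectorSpace) : Set where
  open LeftModuleMorphisms (LeftModule.rawLeftModule V) (LeftModule.rawLeftModule W)
  field
    ⟦_⟧                     : LeftModule.Carrierᴹ V → LeftModule.Carrierᴹ W
    isLeftModuleHomomorphism : IsLeftModuleHomomorphism ⟦_⟧
  open IsLeftModuleHomomorphism isLeftModuleHomomorphism public

record Subspace (V : VectorSpace) : Set₁ where
  open LeftModule V
  field
    Member    : Pred Carrierᴹ 0ℓ
    resp      : ∀ {x y} → x ≈ᴹ y → Member x → Member y
    0-closed  : Member 0ᴹ
    +-closed  : ∀ {x y} → Member x → Member y → Member (x +ᴹ y)
    *ₗ-closed : ∀ a {x} → Member x → Member (a *ₗ x)

  -closed : ∀ {x} → Member x → Member (-ᴹ x)
  -closed {x} = resp (≈ᴹ-sym (VectorSpaceProperties.-x≈x V x))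

open Subspace using (Member)

infixr 7 _∩_

_∩_ : ∀ {V} → Subspace V → Subspace V → Subspace V
S ∩ T = record
  { Member    = λ x → Member S x × Member T x
  ; resp      = λ x≈y (s , t) → S.resp x≈y s , T.resp x≈y t
  ; 0-closed  = S.0-closed , T.0-closed
  ; +-closed  = λ (s , t) (s′ , t′) → S.+-closed s s′ , T.+-closed t t′
  ; *ₗ-closed = λ a (s , t) → S.*ₗ-closed a s , T.*ₗ-closed a t
  }
  where
  module S = Subspace S
  module T = Subspace T

full : ∀ V → Subspace V
full V = record
  { Member    = λ _ → ⊤
  ; resp      = λ _ _ → tt
  ; 0-closed  = tt
  ; +-closed  = λ _ _ → tt
  ; *ₗ-closed = λ _ _ → tt
  }

module _ {V W : VectorSpace} (f : LinearMap V W) where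

  private
    module V = VectorSpaceProperties V
    module W = VectorSpaceProperties W
  open LinearMap f

  kernel : Subspace V
  kernel = record
    { Member    = λ x → ⟦ x ⟧ W.≈ᴹ W.0ᴹ
    ; resp      = λ x≈y fx≈0 → W.≈ᴹ-trans (⟦⟧-cong (V.≈ᴹ-sym x≈y)) fx≈0
    ; 0-closed  = 0ᴹ-homo
    ; +-closed  = λ {x} {y} p q →
        W.≈ᴹ-trans (+ᴹ-homo x y) (W.≈ᴹ-trans (W.+ᴹ-cong p q) (W.+ᴹ-identityˡ W.0ᴹ))
    ; *ₗ-closed = λ a {x} p →
        W.≈ᴹ-trans (*ₗ-homo a x) (W.≈ᴹ-trans (W.*ₗ-cong refl p) (W.*ₗ-zeroʳ a))
    }

  imageOf : Subspace V → Subspace W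
  imageOf S = record
    { Member    = λ y → ∃ λ x → Member S x × ⟦ x ⟧ W.≈ᴹ y
    ; resp      = λ y≈z (x , s , e) → x , s , W.≈ᴹ-trans e y≈z
    ; 0-closed  = V.0ᴹ , S.0-closed , 0ᴹ-homo
    ; +-closed  = λ (x , s , e) (x′ , s′ , e′) →
        x V.+ᴹ x′ , S.+-closed s s′ , W.≈ᴹ-trans (+ᴹ-homo x x′) (W.+ᴹ-cong e e′)
    ; *ₗ-closed = λ a (x , s , e) →
        a V.*ₗ x , S.*ₗ-closed a s , W.≈ᴹ-trans (*ₗ-homo a x) (W.*ₗ-cong refl e)
    }
    where module S = Subspace S

  image : Subspace W
  image = imageOf (full V)

-- The quotient of S by T, for a subspace T contained in S.

infixl 6 _/_

_/_ : ∀ {V} → Subspace V → Subspace V → VectorSpace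
_/_ {V} S T = record
  { Carrierᴹ = Σ Carrierᴹ S.Member
  ; _≈ᴹ_ = λ (x , _) (y , _) → x ∼ y
  ; _+ᴹ_ = λ (x , s) (y , t) → x +ᴹ y , S.+-closed s t
  ; _*ₗ_ = λ a (x , s) → a *ₗ x , S.*ₗ-closed a s
  ; 0ᴹ = 0ᴹ , S.0-closed
  ; -ᴹ_ = λ (x , s) → -ᴹ x , S.-closed s
  ; isLeftModule = record
    { isLeftSemimodule = record
      { +ᴹ-isCommutativeMonoid = record
        { isMonoid = record
          { isSemigroup = record
            { isMagma = record
              { isEquivalence = record
                { refl  = ≈⇒∼ ≈ᴹ-refl
                ; sym   = ∼-sym
                ; trans = ∼-trans
                }
              ; ∙-cong = +-cong
              }
            ; assoc = λ (x , _) (y , _) (z , _) → ≈⇒∼ (+ᴹ-assoc x y z)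
            }
          ; identity = (λ (x , _) → ≈⇒∼ (+ᴹ-identityˡ x)) , (λ (x , _) → ≈⇒∼ (+ᴹ-identityʳ x))
          }
        ; comm = λ (x , _) (y , _) → ≈⇒∼ (+ᴹ-comm x y)
        }
      ; isPreleftSemimodule = record
        { *ₗ-cong      = *-cong
        ; *ₗ-zeroˡ     = λ (x , _) → ≈⇒∼ (*ₗ-zeroˡ x)
        ; *ₗ-distribʳ  = λ (x , _) a b → ≈⇒∼ (*ₗ-distribʳ x a b)
        ; *ₗ-identityˡ = λ (x , _) → ≈⇒∼ (*ₗ-identityˡ x)
        ; *ₗ-assoc     = λ a b (x , _) → ≈⇒∼ (*ₗ-assoc a b x)
        ; *ₗ-zeroʳ     = λ a → ≈⇒∼ (*ₗ-zeroʳ a)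
        ; *ₗ-distribˡ  = λ a (x , _) (y , _) → ≈⇒∼ (*ₗ-distribˡ a x y)
        }
      }
    ; -ᴹ‿cong    = neg-cong
    ; -ᴹ‿inverse = (λ (x , _) → ≈⇒∼ (-ᴹ‿inverseˡ x)) , (λ (x , _) → ≈⇒∼ (-ᴹ‿inverseʳ x))
    }
  }
  where
  open VectorSpaceProperties V
  module S = Subspace S
  module T = Subspace T

  _∼_ : Carrierᴹ → Carrierᴹ → Set
  x ∼ y = T.Member (x +ᴹ -ᴹ y)

  ≈⇒∼ : ∀ {x y} → x ≈ᴹ y → x ∼ y
  ≈⇒∼ x≈y = T.resp (≈ᴹ-sym (x≈y⇒x-y≈0 x≈y)) T.0-closed

  ∼-sym : ∀ {x y} → x ∼ y → y ∼ x
  ∼-sym {x} {y} t = T.resp (begin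
    x +ᴹ -ᴹ y  ≈⟨ +ᴹ-cong (≈ᴹ-sym (-x≈x x)) (-x≈x y) ⟩
    -ᴹ x +ᴹ y  ≈⟨ +ᴹ-comm _ _ ⟩
    y +ᴹ -ᴹ x  ∎) t

  ∼-trans : ∀ {x y z} → x ∼ y → y ∼ z → x ∼ z
  ∼-trans {x} {y} {z} t u = T.resp (begin
    (x +ᴹ -ᴹ y) +ᴹ (y +ᴹ -ᴹ z)  ≈⟨ +ᴹ-assoc _ _ _ ⟩
    x +ᴹ (-ᴹ y +ᴹ (y +ᴹ -ᴹ z))  ≈⟨ +ᴹ-congˡ (+ᴹ-assoc _ _ _) ⟨
    x +ᴹ ((-ᴹ y +ᴹ y) +ᴹ -ᴹ z)  ≈⟨ +ᴹ-congˡ (+ᴹ-congʳ (-ᴹ‿inverseˡ y)) ⟩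
    x +ᴹ (0ᴹ +ᴹ -ᴹ z)           ≈⟨ +ᴹ-congˡ (+ᴹ-identityˡ _) ⟩
    x +ᴹ -ᴹ z                   ∎) (T.+-closed t u)

  +-cong : ∀ {x y u v} → x ∼ y → u ∼ v → (x +ᴹ u) ∼ (y +ᴹ v)
  +-cong {x} {y} {u} {v} t t′ = T.resp (begin
    (x +ᴹ -ᴹ y) +ᴹ (u +ᴹ -ᴹ v)  ≈⟨ interchange _ _ _ _ ⟩
    (x +ᴹ u) +ᴹ (-ᴹ y +ᴹ -ᴹ v)  ≈⟨ +ᴹ-congˡ (⁻¹-∙-comm y v) ⟩
    (x +ᴹ u) +ᴹ -ᴹ (y +ᴹ v)     ∎) (T.+-closed t t′)

  *-cong : ∀ {a b x y} → a ≡ b → x ∼ y → (a *ₗ x) ∼ (b *ₗ y)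
  *-cong {a} {_} {x} {y} refl t = T.resp (begin
    a *ₗ (x +ᴹ -ᴹ y)       ≈⟨ *ₗ-cong refl (+ᴹ-congˡ (-x≈x y)) ⟩
    a *ₗ (x +ᴹ y)          ≈⟨ *ₗ-distribˡ a x y ⟩
    a *ₗ x +ᴹ a *ₗ y       ≈⟨ +ᴹ-congˡ (-x≈x _) ⟨
    a *ₗ x +ᴹ -ᴹ (a *ₗ y)  ∎) (T.*ₗ-closed a t)

  neg-cong : ∀ {x y} → x ∼ y → (-ᴹ x) ∼ (-ᴹ y)
  neg-cong {x} {y} t = T.resp (≈ᴹ-sym (⁻¹-∙-comm x (-ᴹ y))) (T.-closed t)

module _ (V : VectorSpace) where

  open VectorSpaceProperties V

  linearCombination : ∀ {d} → Vector Bool d → Vector Carrierᴹ d → Carrierᴹ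
  linearCombination {d} a v = ∑[ i < d ] (a i *ₗ v i)

  LinearlyIndependent : ∀ {d} → Pred (Vector Carrierᴹ d) 0ℓ
  LinearlyIndependent v = ∀ a → linearCombination a v ≈ᴹ 0ᴹ → ∀ i → a i ≡ false

  InSpan : ∀ {d} → Vector Carrierᴹ d → Pred Carrierᴹ 0ℓ
  InSpan v x = ∃ λ a → x ≈ᴹ linearCombination a v

  record Basis (d : ℕ) : Set where
    field
      vectors     : Vector Carrierᴹ d
      independent : LinearlyIndependent vectors
      spanning    : ∀ x → InSpan vectors x

  record Finite : Set where
    field
      elements : List Carrierᴹ
      complete : ∀ x → Any (x ≈ᴹ_) elements
      _≟_      : Decidable₂ _≈ᴹ_

-- A finite vector space has a basis, extracted greedily from its list of
-- elements.

module _ {V : VectorSpace} (finite : Finite V) where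

  open VectorSpaceProperties V
  open Finite finite

  private
    lc = linearCombination V

  inSpan? : ∀ {d} (v : Vector Carrierᴹ d) → Decidable (InSpan V v)
  inSpan? {zero}  v x = Dec.map′ (λ e → (λ ()) , e) proj₂ (x ≟ 0ᴹ)
  inSpan? {suc d} v x with inSpan? (Vector.tail v) x
  ... | yes (a , e) = yes (false Vector.∷ a , (begin
    x                            ≈⟨ e ⟩
    lc a (Vector.tail v)         ≈⟨ +ᴹ-identityˡ _ ⟨
    0ᴹ +ᴹ lc a (Vector.tail v)   ≈⟨ +ᴹ-congʳ (*ₗ-zeroˡ _) ⟨
    false *ₗ v zero +ᴹ lc a (Vector.tail v) ∎))
  ... | no x∉ with inSpan? (Vector.tail v) (v zero +ᴹ x)
  ...   | yes (a , e) = yes (true Vector.∷ a , (begin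
    x                                    ≈⟨ +ᴹ-identityˡ x ⟨
    0ᴹ +ᴹ x                              ≈⟨ +ᴹ-congʳ (x+x≈0 (v zero)) ⟨
    (v zero +ᴹ v zero) +ᴹ x              ≈⟨ +ᴹ-assoc _ _ _ ⟩
    v zero +ᴹ (v zero +ᴹ x)              ≈⟨ +ᴹ-cong (≈ᴹ-sym (*ₗ-identityˡ _)) e ⟩
    true *ₗ v zero +ᴹ lc a (Vector.tail v) ∎))
  ...   | no v₀+x∉ = no impossible
    where
    impossible : ¬ InSpan V v x
    impossible (a , e) with a zero
    ... | false = x∉ (Vector.tail a , (begin
      x                                                ≈⟨ e ⟩
      false *ₗ v zero +ᴹ lc (Vector.tail a) (Vector.tail v) ≈⟨ +ᴹ-congʳ (*ₗ-zeroˡ _) ⟩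
      0ᴹ +ᴹ lc (Vector.tail a) (Vector.tail v)         ≈⟨ +ᴹ-identityˡ _ ⟩
      lc (Vector.tail a) (Vector.tail v)               ∎))
    ... | true = v₀+x∉ (Vector.tail a , (begin
      v zero +ᴹ x                                      ≈⟨ +ᴹ-congˡ e ⟩
      v zero +ᴹ (true *ₗ v zero +ᴹ r)                  ≈⟨ +ᴹ-assoc _ _ _ ⟨
      (v zero +ᴹ true *ₗ v zero) +ᴹ r                  ≈⟨ +ᴹ-congʳ (+ᴹ-congˡ (*ₗ-identityˡ _)) ⟩
      (v zero +ᴹ v zero) +ᴹ r                          ≈⟨ +ᴹ-congʳ (x+x≈0 _) ⟩
      0ᴹ +ᴹ r                                          ≈⟨ +ᴹ-identityˡ _ ⟩
      r                                                ∎))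
      where r = lc (Vector.tail a) (Vector.tail v)

  inSpan-∷ : ∀ {d x y} {v : Vector Carrierᴹ d} → InSpan V v y → InSpan V (x Vector.∷ v) y
  inSpan-∷ (a , e) = false Vector.∷ a ,
    ≈ᴹ-trans e (≈ᴹ-trans (≈ᴹ-sym (+ᴹ-identityˡ _)) (+ᴹ-congʳ (≈ᴹ-sym (*ₗ-zeroˡ _))))

  inSpan-head : ∀ {d x} {v : Vector Carrierᴹ d} → InSpan V (x Vector.∷ v) x
  inSpan-head {d} {x} {v} = true Vector.∷ const false , (begin
    x                                ≈⟨ +ᴹ-identityʳ x ⟨
    x +ᴹ 0ᴹ                          ≈⟨ +ᴹ-cong (≈ᴹ-sym (*ₗ-identityˡ x)) (≈ᴹ-sym (zeros v)) ⟩
    true *ₗ x +ᴹ lc (const false) v  ∎)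
    where
    zeros : ∀ {d} (v : Vector Carrierᴹ d) → lc (const false) v ≈ᴹ 0ᴹ
    zeros {zero}  v = ≈ᴹ-refl
    zeros {suc d} v =
      ≈ᴹ-trans (+ᴹ-cong (*ₗ-zeroˡ _) (zeros (Vector.tail v))) (+ᴹ-identityˡ 0ᴹ)

  independent-∷ : ∀ {d x} {v : Vector Carrierᴹ d} → LinearlyIndependent V v →
                  ¬ InSpan V v x → LinearlyIndependent V (x Vector.∷ v)
  independent-∷ {d} {x} {v} ind x∉ a e with a zero in a₀
  ... | true  = contradiction (Vector.tail a , (begin
    x                            ≈⟨ *ₗ-identityˡ x ⟨
    true *ₗ x                    ≈⟨ uniqueˡ‿-ᴹ _ _ e ⟩
    -ᴹ lc (Vector.tail a) v      ≈⟨ -x≈x _ ⟩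
    lc (Vector.tail a) v         ∎)) x∉
  ... | false = λ where
    zero    → a₀
    (suc i) → ind (Vector.tail a) (begin
      lc (Vector.tail a) v                ≈⟨ +ᴹ-identityˡ _ ⟨
      0ᴹ +ᴹ lc (Vector.tail a) v          ≈⟨ +ᴹ-congʳ (*ₗ-zeroˡ x) ⟨
      false *ₗ x +ᴹ lc (Vector.tail a) v  ≈⟨ e ⟩
      0ᴹ                                  ∎) i

  extractBasis : (xs : List Carrierᴹ) →
    ∃ λ d → Σ (Vector Carrierᴹ d) λ v → LinearlyIndependent V v × All (InSpan V v) xs
  extractBasis []       = 0 , (λ ()) , (λ _ _ ()) , []
  extractBasis (x ∷ xs) with extractBasis xs
  ... | d , v , ind , xs∈ with inSpan? v x
  ...   | yes x∈ = d , v , ind , x∈ ∷ xs∈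
  ...   | no  x∉ = suc d , x Vector.∷ v , independent-∷ ind x∉ ,
                   inSpan-head ∷ All.map inSpan-∷ xs∈

  basis : ∃ (Basis V)
  basis with extractBasis elements
  ... | d , v , ind , span = d , record
    { vectors     = v
    ; independent = ind
    ; spanning    = λ x → All.lookupWith (λ (a , e) x≈y → a , ≈ᴹ-trans x≈y e) span (complete x)
    }

  dimension : ℕ
  dimension = proj₁ basis

-- All bases of a vector space have the same size, so that the dimension
-- does not depend on the basis extracted above.

module _ {V : VectorSpace} where

  open VectorSpaceProperties V

  private
    lc-+ : ∀ {d} (a b : Vector Bool d) (v : Vector Carrierᴹ d) →
           linearCombination V (λ i → a i xor b i) v ≈ᴹ
           linearCombination V a v +ᴹ linearCombination V b v
    lc-+ a b v = ≈ᴹ-trans (sum-cong-≋ (λ i → *ₗ-distribʳ (v i) (a i) (b i)))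
                          (∑-distrib-+ (λ i → a i *ₗ v i) (λ i → b i *ₗ v i))

    xor-false⇒≡ : ∀ a b → a xor b ≡ false → a ≡ b
    xor-false⇒≡ false false _ = refl
    xor-false⇒≡ true  true  _ = refl

    funToFin-cong : ∀ {m n} {f g : Fin m → Fin n} → (∀ i → f i ≡ g i) → funToFin f ≡ funToFin g
    funToFin-cong {zero}  eq = refl
    funToFin-cong {suc m} eq = cong₂ combine (eq zero) (funToFin-cong (eq ∘ suc))

  independent⇒≤spanning : ∀ {d e} {v : Vector Carrierᴹ d} {w : Vector Carrierᴹ e} →
    LinearlyIndependent V v → (∀ x → InSpan V w x) → d ℕ.≤ e
  independent⇒≤spanning {d} {e} {v} {w} ind span =
    ℕ.≮⇒≥ λ e<d → ℕ.<⇒≱ (ℕ.^-monoʳ-< 2 (s≤s (s≤s ℕ.z≤n)) e<d) (Fin.injective⇒≤ φ-injective)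
    where
    open Inverse Fin.2↔Bool

    coefficients : Fin (2 ℕ.^ d) → Vector Bool d
    coefficients k i = to (finToFun k i)

    coordinates : Fin (2 ℕ.^ d) → Vector Bool e
    coordinates k = proj₁ (span (linearCombination V (coefficients k) v))

    φ : Fin (2 ℕ.^ d) → Fin (2 ℕ.^ e)
    φ k = funToFin (from ∘ coordinates k)

    to-injective : ∀ {x y} → to x ≡ to y → x ≡ y
    to-injective eq = trans (sym (strictlyInverseʳ _)) (trans (cong from eq) (strictlyInverseʳ _))

    φ-injective : ∀ {k l} → φ k ≡ φ l → k ≡ l
    φ-injective {k} {l} eq =
      trans (sym (Fin.funToFin-finToFin {d} {2} k))
        (trans (funToFin-cong (λ i → to-injective (a≗b i))) (Fin.funToFin-finToFin {d} {2} l))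
      where
      a = coefficients k
      b = coefficients l

      coordinates≗ : ∀ i → coordinates k i ≡ coordinates l i
      coordinates≗ i = trans (sym (strictlyInverseˡ _)) (trans (cong to (trans
        (sym (Fin.finToFun-funToFin (from ∘ coordinates k) i))
        (trans (cong (λ z → finToFun z i) eq) (Fin.finToFun-funToFin (from ∘ coordinates l) i))))
        (strictlyInverseˡ _))

      equal : linearCombination V a v ≈ᴹ linearCombination V b v
      equal = begin
        linearCombination V a v                ≈⟨ proj₂ (span _) ⟩
        linearCombination V (coordinates k) w
          ≈⟨ sum-cong-≋ (λ i → *ₗ-cong (coordinates≗ i) ≈ᴹ-refl) ⟩
        linearCombination V (coordinates l) w  ≈⟨ proj₂ (span _) ⟨
        linearCombination V b v                ∎

      a≗b : ∀ i → a i ≡ b i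
      a≗b i = xor-false⇒≡ (a i) (b i) (ind (λ j → a j xor b j)
        (≈ᴹ-trans (lc-+ a b v) (≈ᴹ-trans (+ᴹ-congʳ equal) (x+x≈0 _))) i)

  dimension-unique : ∀ {d} (finite : Finite V) → Basis V d → d ≡ dimension finite
  dimension-unique finite b = ℕ.≤-antisym
    (independent⇒≤spanning (Basis.independent b) (Basis.spanning b′))
    (independent⇒≤spanning (Basis.independent b′) (Basis.spanning b))
    where b′ = proj₂ (basis finite)

module _ {A : Set} {P : Pred A 0ℓ} (P? : Decidable P) where

  select : List A → List (Σ A P)
  select []       = []
  select (x ∷ xs) with P? x
  ... | yes p = (x , p) ∷ select xs
  ... | no  _ = select xs

  select⁺ : ∀ {Q : Pred A 0ℓ} {R : Pred (Σ A P) 0ℓ} → Q ⊆ P → (∀ {x} p → Q x → R (x , p)) →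
            ∀ {xs} → Any Q xs → Any R (select xs)
  select⁺ Q⊆P Q⇒R {x ∷ xs} any with P? x | any
  ... | yes p | here q = here (Q⇒R p q)
  ... | no ¬p | here q = contradiction (Q⊆P q) ¬p
  ... | yes _ | there qs = there (select⁺ Q⊆P Q⇒R qs)
  ... | no  _ | there qs = select⁺ Q⊆P Q⇒R qs

  select-All : ∀ {Q : Pred A 0ℓ} {xs} → All Q xs → All (Q ∘ proj₁) (select xs)
  select-All []                  = []
  select-All {xs = x ∷ _} (q ∷ qs) with P? x
  ... | yes _ = q ∷ select-All qs
  ... | no  _ = select-All qs

  select-Unique : ∀ {xs} → Unique xs → AllPairs (λ x y → proj₁ x ≢ proj₁ y) (select xs)
  select-Unique []                  = []
  select-Unique {x ∷ _} (x∉ ∷ uniq) with P? x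
  ... | yes _ = select-All x∉ ∷ select-Unique uniq
  ... | no  _ = select-Unique uniq

module _ {V W : VectorSpace} (finV : Finite V) (finW : Finite W) (f : LinearMap V W) where

  private
    module V = LeftModule V
    module W = LeftModule W
  open LinearMap f

  kernel? : Decidable (Member (kernel f))
  kernel? x = Finite._≟_ finW ⟦ x ⟧ W.0ᴹ

  imageOf? : (S : Subspace V) → Decidable (Member S) → Decidable (Member (imageOf f S))
  imageOf? S S? y = Dec.map′ Any.satisfied
    (λ (x , s , e) → Any.map
      (λ x≈z → Subspace.resp S x≈z s , W.≈ᴹ-trans (⟦⟧-cong (V.≈ᴹ-sym x≈z)) e)
      (Finite.complete finV x))
    (any? (λ x → S? x ×-dec Finite._≟_ finW ⟦ x ⟧ y) (Finite.elements finV))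

  image? : Decidable (Member (image f))
  image? = imageOf? (full V) (λ _ → yes tt)

∩? : ∀ {V} (S T : Subspace V) → Decidable (Member S) → Decidable (Member T) →
     Decidable (Member (S ∩ T))
∩? S T S? T? x = S? x ×-dec T? x

/-finite : ∀ {V} → Finite V → (S T : Subspace V) →
           Decidable (Member S) → Decidable (Member T) → Finite (S / T)
/-finite {V} finite S T S? T? = record
  { elements = select S? elements
  ; complete = λ (x , s) → select⁺ S? (λ x≈y → Subspace.resp S x≈y s)
      (λ _ x≈y → Subspace.resp T (≈ᴹ-sym (x≈y⇒x-y≈0 x≈y)) (Subspace.0-closed T)) (complete x)
  ; _≟_ = λ (x , _) (y , _) → T? (x +ᴹ -ᴹ y)
  }
  where
  open VectorSpaceProperties V
  open Finite finite

record Enumeration (X : Set) : Set where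
  field
    elements : List X
    complete : ∀ x → x ∈ elements
    unique   : Unique elements
    _≟_      : DecidableEquality X

Free : Set → VectorSpace
Free X = record
  { Carrierᴹ = X → Bool
  ; _≈ᴹ_ = λ c c′ → ∀ x → c x ≡ c′ x
  ; _+ᴹ_ = λ c c′ x → c x xor c′ x
  ; _*ₗ_ = λ a c x → a ∧ c x
  ; 0ᴹ = λ _ → false
  ; -ᴹ_ = λ c x → ℤ₂.- c x
  ; isLeftModule = record
    { isLeftSemimodule = record
      { +ᴹ-isCommutativeMonoid = record
        { isMonoid = record
          { isSemigroup = record
            { isMagma = record
              { isEquivalence = record
                { refl  = λ _ → refl
                ; sym   = λ e x → sym (e x)
                ; trans = λ e e′ x → trans (e x) (e′ x)
                }
              ; ∙-cong = λ e e′ x → cong₂ _xor_ (e x) (e′ x)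
              }
            ; assoc = λ b c d x → ℤ₂.+-assoc (b x) (c x) (d x)
            }
          ; identity = (λ c x → ℤ₂.+-identityˡ (c x)) , (λ c x → ℤ₂.+-identityʳ (c x))
          }
        ; comm = λ b c x → ℤ₂.+-comm (b x) (c x)
        }
      ; isPreleftSemimodule = record
        { *ₗ-cong      = λ e e′ x → cong₂ _∧_ e (e′ x)
        ; *ₗ-zeroˡ     = λ c x → ℤ₂.zeroˡ (c x)
        ; *ₗ-distribʳ  = λ c a b x → ℤ₂.distribʳ (c x) a b
        ; *ₗ-identityˡ = λ c x → ℤ₂.*-identityˡ (c x)
        ; *ₗ-assoc     = λ a b c x → ℤ₂.*-assoc a b (c x)
        ; *ₗ-zeroʳ     = λ a x → ℤ₂.zeroʳ a
        ; *ₗ-distribˡ  = λ a b c x → ℤ₂.distribˡ a (b x) (c x)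
        }
      }
    ; -ᴹ‿cong    = λ e x → cong ℤ₂.-_ (e x)
    ; -ᴹ‿inverse = (λ c x → ℤ₂.-‿inverseˡ (c x)) , (λ c x → ℤ₂.-‿inverseʳ (c x))
    }
  }

module _ {X : Set} (enum : Enumeration X) where

  open Enumeration enum

  generator : X → X → Bool
  generator x y = does (x ≟ y)

  -- The linear map Free X → V sending each generator x to f x.

  extend : (V : VectorSpace) → (X → LeftModule.Carrierᴹ V) → LinearMap (Free X) V
  extend V f = record
    { ⟦_⟧ = λ c → total c elements
    ; isLeftModuleHomomorphism = record
      { +ᴹ-isGroupHomomorphism = record
        { isMonoidHomomorphism = record
          { isMagmaHomomorphism = record
            { isRelHomomorphism = record { cong = λ e → total-cong e elements }
            ; homo = λ c c′ → total-+ c c′ elements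
            }
          ; ε-homo = total-0 elements
          }
        ; ⁻¹-homo = λ c → ≈ᴹ-sym (-x≈x _)
        }
      ; *ₗ-homo = λ a c → total-* a c elements
      }
    }
    where
    open VectorSpaceProperties V

    total : (X → Bool) → List X → Carrierᴹ
    total c = foldr (λ x s → c x *ₗ f x +ᴹ s) 0ᴹ

    total-cong : ∀ {c c′} → (∀ x → c x ≡ c′ x) → ∀ xs → total c xs ≈ᴹ total c′ xs
    total-cong e []       = ≈ᴹ-refl
    total-cong e (x ∷ xs) = +ᴹ-cong (*ₗ-cong (e x) ≈ᴹ-refl) (total-cong e xs)

    total-0 : ∀ xs → total (const false) xs ≈ᴹ 0ᴹ
    total-0 []       = ≈ᴹ-refl
    total-0 (x ∷ xs) = ≈ᴹ-trans (+ᴹ-cong (*ₗ-zeroˡ _) (total-0 xs)) (+ᴹ-identityˡ 0ᴹ)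

    total-+ : ∀ c c′ xs → total (λ x → c x xor c′ x) xs ≈ᴹ total c xs +ᴹ total c′ xs
    total-+ c c′ []       = ≈ᴹ-sym (+ᴹ-identityˡ 0ᴹ)
    total-+ c c′ (x ∷ xs) = ≈ᴹ-trans
      (+ᴹ-cong (*ₗ-distribʳ (f x) (c x) (c′ x)) (total-+ c c′ xs)) (interchange _ _ _ _)

    total-* : ∀ a c xs → total (λ x → a ∧ c x) xs ≈ᴹ a *ₗ total c xs
    total-* a c []       = ≈ᴹ-sym (*ₗ-zeroʳ a)
    total-* a c (x ∷ xs) = ≈ᴹ-trans
      (+ᴹ-cong (*ₗ-assoc a (c x) (f x)) (total-* a c xs)) (≈ᴹ-sym (*ₗ-distribˡ a _ _))

  extend-generator : ∀ V f x →
    LeftModule._≈ᴹ_ V (LinearMap.⟦_⟧ (extend V f) (generator x)) (f x)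
  extend-generator V f x = found unique (complete x)
    where
    open VectorSpaceProperties V

    total : List X → Carrierᴹ
    total = foldr (λ y s → generator x y *ₗ f y +ᴹ s) 0ᴹ

    absent : ∀ {xs} → All (x ≢_) xs → total xs ≈ᴹ 0ᴹ
    absent []                   = ≈ᴹ-refl
    absent {y ∷ _} (x≢y ∷ x∉) with x ≟ y
    ... | yes x≡y = contradiction x≡y x≢y
    ... | no  _   = ≈ᴹ-trans (+ᴹ-cong (*ₗ-zeroˡ _) (absent x∉)) (+ᴹ-identityˡ 0ᴹ)

    found : ∀ {xs} → Unique xs → x ∈ xs → total xs ≈ᴹ f x
    found {y ∷ _} (y∉ ∷ uniq) x∈ with x ≟ y | x∈
    ... | yes refl | _        =
      ≈ᴹ-trans (+ᴹ-cong (*ₗ-identityˡ _) (absent y∉)) (+ᴹ-identityʳ (f x))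
    ... | no x≢y   | here x≡y = contradiction x≡y x≢y
    ... | no _     | there p  =
      ≈ᴹ-trans (+ᴹ-cong (*ₗ-zeroˡ _) (found uniq p)) (+ᴹ-identityˡ (f x))

  Free-finite : Finite (Free X)
  Free-finite = record
    { elements = functions elements
    ; complete = λ c → Any.map (λ e x → e (complete x)) (functions-complete c elements)
    ; _≟_      = λ c c′ → Dec.map′ (λ e x → All.lookup e (complete x)) (λ e → All.universal e _)
                            (All.all? (λ x → c x Bool.≟ c′ x) elements)
    }
    where
    update : X → Bool → (X → Bool) → X → Bool
    update x b c y with y ≟ x
    ... | yes _ = b
    ... | no  _ = c y

    functions : List X → List (X → Bool)
    functions []       = const false ∷ []
    functions (x ∷ xs) = cartesianProductWith (update x) (true ∷ false ∷ []) (functions xs)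

    functions-complete : ∀ c xs → Any (λ c′ → ∀ {x} → x ∈ xs → c x ≡ c′ x) (functions xs)
    functions-complete c []       = here λ ()
    functions-complete c (x ∷ xs) =
      Any.cartesianProductWith⁺ (update x) agree (bool (c x)) (functions-complete c xs)
      where
      bool : ∀ b → Any (b ≡_) (true ∷ false ∷ [])
      bool true  = here refl
      bool false = there (here refl)

      agree : ∀ {b c′} → c x ≡ b → (∀ {y} → y ∈ xs → c y ≡ c′ y) →
              ∀ {y} → y ∈ x ∷ xs → c y ≡ update x b c′ y
      agree cx≡b e {y} y∈ with y ≟ x | y∈
      ... | yes refl | _        = cx≡b
      ... | no y≢x   | here y≡x = contradiction y≡x y≢x
      ... | no _     | there p  = e p

-- Vertices are the elements of Fin N.  A set of simplices is a decidable
-- predicate, as is classically any subset of a finite set.  The empty simplex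
-- is not excluded; it has dimension -1, so d 0 is the augmentation map and
-- homology is indexed by all integers.

record SimplicialComplex (N : ℕ) : Set₁ where
  field
    Has        : Pred (Subset N) 0ℓ
    has?       : Decidable Has
    downClosed : ∀ {σ τ} → τ ⊆ˢ σ → Has σ → Has τ

open SimplicialComplex using (Has)

record Simplex {N} (K : SimplicialComplex N) (n : ℤ) : Set where
  constructor simplex
  field
    vertices : Subset N
    .dim     : + ∣ vertices ∣ ≡ n ℤ.+ 1ℤ
    .has     : Has K vertices

open Simplex using (vertices)

private
  +1-cancel : ∀ i j → i ℤ.+ 1ℤ ≡ j ℤ.+ 1ℤ → i ≡ j
  +1-cancel i j e = trans (shift i) (trans (cong (ℤ._- 1ℤ) e) (sym (shift j)))
    where
    shift : ∀ i → i ≡ (i ℤ.+ 1ℤ) ℤ.- 1ℤ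
    shift i = sym (trans (ℤ.+-assoc i 1ℤ (ℤ.- 1ℤ)) (ℤ.+-identityʳ i))

  -1+1 : ∀ n → (n ℤ.- 1ℤ) ℤ.+ 1ℤ ≡ n
  -1+1 n = trans (ℤ.+-assoc n (ℤ.- 1ℤ) 1ℤ) (ℤ.+-identityʳ n)

  ∣p∣≡1+∣p∖x∣ : ∀ {N} {p : Subset N} {x} → x ∈ˢ p → ∣ p ∣ ≡ suc ∣ p ∖ x ∣
  ∣p∣≡1+∣p∖x∣ {p = true ∷ p}  here       = cong (suc ∘ ∣_∣) (sym (p─⊥≡p p))
  ∣p∣≡1+∣p∖x∣ {p = true ∷ p}  (there x∈) = cong suc (∣p∣≡1+∣p∖x∣ x∈)
  ∣p∣≡1+∣p∖x∣ {p = false ∷ p} (there x∈) = ∣p∣≡1+∣p∖x∣ x∈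

module _ {N} (K : SimplicialComplex N) where

  open SimplicialComplex K using (has?; downClosed)

  simplices : ∀ n → Enumeration (Simplex K n)
  simplices n = record
    { elements = map toSimplex (select P? (subsets N))
    ; complete = λ where
        (simplex σ d h) → Any.map⁺ (select⁺ P?
          (λ { refl → recompute-P d h }) (λ { _ refl → refl }) (subsets-complete σ))
    ; unique   = AllPairs.map⁺ (AllPairs.map (λ σ≢τ → σ≢τ ∘ cong vertices)
                   (select-Unique P? (subsets-unique N)))
    ; _≟_      = λ where
        (simplex σ _ _) (simplex τ _ _) →
          Dec.map′ (λ { refl → refl }) (cong vertices) (Vec.≡-dec Bool._≟_ σ τ)
    }
    where
    P : Pred (Subset N) 0ℓ
    P σ = + ∣ σ ∣ ≡ n ℤ.+ 1ℤ × Has K σ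

    P? : Decidable P
    P? σ = (+ ∣ σ ∣ ℤ.≟ n ℤ.+ 1ℤ) ×-dec has? σ

    recompute-P : ∀ {σ} → .(+ ∣ σ ∣ ≡ n ℤ.+ 1ℤ) → .(Has K σ) → P σ
    recompute-P {σ} d h = Dec.recompute (P? σ) (d , h)

    toSimplex : Σ (Subset N) P → Simplex K n
    toSimplex (σ , d , h) = simplex σ d h

    sides : List Bool
    sides = true ∷ false ∷ []

    subsets : ∀ N → List (Subset N)
    subsets zero    = [] ∷ []
    subsets (suc N) = cartesianProductWith _∷_ sides (subsets N)

    subsets-complete : ∀ {N} (σ : Subset N) → σ ∈ subsets N
    subsets-complete []          = here refl
    subsets-complete (true ∷ σ)  = ∈-cartesianProductWith⁺ _∷_ {xs = sides} (here refl) (subsets-complete σ)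
    subsets-complete (false ∷ σ) =
      ∈-cartesianProductWith⁺ _∷_ {xs = sides} (there (here refl)) (subsets-complete σ)

    subsets-unique : ∀ N → Unique (subsets N)
    subsets-unique zero    = [] ∷ []
    subsets-unique (suc N) = Unique.cartesianProductWith⁺ _∷_ Vec.∷-injective
      (((λ ()) ∷ []) ∷ [] ∷ []) (subsets-unique N)

  C : ℤ → VectorSpace
  C n = Free (Simplex K n)

  C-finite : ∀ n → Finite (C n)
  C-finite n = Free-finite (simplices n)

  face : ∀ {n k} → .(k ℤ.+ 1ℤ ≡ n) → (σ : Simplex K n) → ∀ v → v ∈ˢ vertices σ → Simplex K k
  face {n} {k} k+1≡n (simplex σ d h) v v∈σ = simplex (σ ∖ v)
    (trans (+1-cancel (+ ∣ σ ∖ v ∣) n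
      (trans (trans (ℤ.+-comm (+ ∣ σ ∖ v ∣) 1ℤ) (cong +_ (sym (∣p∣≡1+∣p∖x∣ v∈σ)))) d)) (sym k+1≡n))
    (downClosed (p─q⊆p σ Subset.⁅ v ⁆) h)

  -- The differential C n → C k for k + 1 ≡ n; the two indices are kept apart
  -- because (n - 1) + 1 and (n + 1) - 1 do not reduce to n.  The i-th face of
  -- (v₀, …, vₙ) omits vᵢ, so the faces are indexed by the vertices; their order
  -- does not matter in the sum.

  ∂ : ∀ n k → .(k ℤ.+ 1ℤ ≡ n) → LinearMap (C n) (C k)
  ∂ n k k+1≡n = extend (simplices n) (C k) λ σ →
    ∑where (LeftModule.+ᴹ-commutativeMonoid (C k)) (_∈ˢ? vertices σ)
      (λ v v∈σ → generator (simplices k) (face k+1≡n σ v v∈σ))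

  d : ∀ n → LinearMap (C n) (C (n ℤ.- 1ℤ))
  d n = ∂ n (n ℤ.- 1ℤ) (-1+1 n)

  Z : ∀ n → Subspace (C n)
  Z n = kernel (d n)

  B : ∀ n → Subspace (C n)
  B n = image (∂ (n ℤ.+ 1ℤ) n refl)

  Z? : ∀ n → Decidable (Member (Z n))
  Z? n = kernel? (C-finite n) (C-finite (n ℤ.- 1ℤ)) (d n)

  B? : ∀ n → Decidable (Member (B n))
  B? n = image? (C-finite (n ℤ.+ 1ℤ)) (C-finite n) (∂ (n ℤ.+ 1ℤ) n refl)

module _ {N} {K L : SimplicialComplex N} (K⊆L : Has K ⊆ Has L) (n : ℤ) where

  inclusion : LinearMap (C K n) (C L n)
  inclusion = extend (simplices K n) (C L n) λ where
    (simplex σ d h) → generator (simplices L n) (simplex σ d (K⊆L h))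

  private
    iZ : Subspace (C L n)
    iZ = imageOf inclusion (Z K n)

    iZ? : Decidable (Member iZ)
    iZ? = imageOf? (C-finite K n) (C-finite L n) inclusion (Z K n) (Z? K n)

  persistentHomology : VectorSpace
  persistentHomology = iZ / (B L n ∩ iZ)

  persistentHomology-finite : Finite persistentHomology
  persistentHomology-finite =
    /-finite (C-finite L n) iZ (B L n ∩ iZ) iZ? (∩? (B L n) iZ (B? L n) iZ?)

  bettiNumber : ℕ
  bettiNumber = dimension persistentHomology-finite

record Filtration {N} (𝒦 : SimplicialComplex N) (m : ℕ) : Set₁ where
  field
    K    : Fin (suc m) → SimplicialComplex N
    step : ∀ (i : Fin m) → Has (K (inject₁ i)) ⊆ Has (K (suc i))
    top  : Has (K (fromℕ m)) ≐ Has 𝒦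

  K-mono : ∀ {j p} → j ≤ᶠ p → Has (K j) ⊆ Has (K p)
  K-mono {j} {p} = mono K step j p
    where
    mono : ∀ {m} (K : Fin (suc m) → SimplicialComplex N) →
           (∀ (i : Fin m) → Has (K (inject₁ i)) ⊆ Has (K (suc i))) →
           ∀ j p → j ≤ᶠ p → Has (K j) ⊆ Has (K p)
    mono         K step zero    zero    _         = id
    mono {suc _} K step zero    (suc p) _         = mono (K ∘ suc) (step ∘ suc) zero p ℕ.z≤n ∘ step zero
    mono {suc _} K step (suc j) (suc p) (s≤s j≤p) = mono (K ∘ suc) (step ∘ suc) j p j≤p

module _ {N m} {𝒦 : SimplicialComplex N} (F : Filtration 𝒦 m) (n : ℤ) where

  open Filtration F

  H : ∀ (j p : Fin (suc m)) → j ≤ᶠ p → VectorSpace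
  H j p j≤p = persistentHomology {K = K j} {K p} (K-mono j≤p) n

  β : ∀ (j p : Fin (suc m)) → j ≤ᶠ p → ℕ
  β j p j≤p = bettiNumber {K = K j} {K p} (K-mono j≤p) n

  β-dimension : ∀ j p (j≤p : j ≤ᶠ p) → Basis (H j p j≤p) (β j p j≤p)
  β-dimension j p j≤p = proj₂ (basis (persistentHomology-finite {K = K j} {K p} (K-mono j≤p) n))

  -- β₋₁ j p is β (j - 1) p, which is 0 by convention when j = 0.

  β₋₁ : ∀ (j p : Fin (suc m)) → j ≤ᶠ p → ℕ
  β₋₁ zero    p _   = 0
  β₋₁ (suc j) p j<p = β (inject₁ j) p (ℕ.<⇒≤ (subst (ℕ._< toℕ p) (sym (Fin.toℕ-inject₁ j)) j<p))

  μ : ∀ (j p : Fin (suc m)) → j <ᶠ p → ℤ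
  μ j (suc p) j<1+p =
    (+ β   j (inject₁ p) j≤p ℤ.- + β   j (suc p) (ℕ.<⇒≤ j<1+p)) ℤ.-
    (+ β₋₁ j (inject₁ p) j≤p ℤ.- + β₋₁ j (suc p) (ℕ.<⇒≤ j<1+p))
    where
    j≤p : j ≤ᶠ inject₁ p
    j≤p = subst (toℕ j ℕ.≤_) (sym (Fin.toℕ-inject₁ p)) (ℕ.s≤s⁻¹ j<1+p)

{-# OPTIONS --safe #-}

-- The double sum telescopes: for fixed i, the sum of μ i j over l < j ≤ m is
-- (β i l - β i m) - (β (i - 1) l - β (i - 1) m), and summing this over 0 ≤ i ≤ k leaves
-- β k l - β k m, because β (-1) p = 0.
module Submission where

open import Defs
open import Algebra.Bundles using (CommutativeMonoid)
import Algebra.Properties.CommutativeMonoid.Sum as FiniteSum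
open import Data.Fin.Base using (Fin; zero; suc; fromℕ; inject₁; toℕ) renaming (_≤_ to _≤ᶠ_; _<_ to _<ᶠ_)
open import Data.Fin.Properties using (_≤?_; _<?_; ≤fromℕ; toℕ-inject₁)
open import Data.Integer.Base using (ℤ; +_; _+_; _-_; 0ℤ)
open import Data.Integer.Properties using (+-0-commutativeMonoid; +-identityˡ; +-identityʳ; +-inverseʳ)
open import Data.Integer.Tactic.RingSolver using (solve-∀)
open import Data.Nat.Base as ℕ using (ℕ; zero; suc; z≤n; s≤s; s≤s⁻¹)
open import Data.Nat.Properties using (≤-refl; ≤-trans; ≤-<-trans; ≤-irrelevant; <⇒≤)
open import Function.Base using (id)
open import Level using (Level)
open import Relation.Binary.PropositionalEquality using (_≡_; refl; sym; trans; cong; cong₂; subst; module ≡-Reasoning)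
open import Relation.Nullary using (Dec; yes; no; ¬_; contradiction)
open import Relation.Unary using (Pred; Decidable)

open FiniteSum +-0-commutativeMonoid using (sum; sum-cong-≋; sum-replicate-zero)

module _ {a ℓ p q : Level} (M : CommutativeMonoid a ℓ) where

  open CommutativeMonoid M using (Carrier; _≈_) renaming (refl to ≈-refl)

  when-cong : ∀ {P : Set p} {Q : Set q} (P? : Dec P) (Q? : Dec Q) {f : P → Carrier} {g : Q → Carrier} →
              (P → Q) → (Q → P) → (∀ p q → f p ≈ g q) → when M P? f ≈ when M Q? g
  when-cong (yes p) (yes q) P⇒Q Q⇒P f≈g = f≈g p q
  when-cong (yes p) (no ¬q) P⇒Q Q⇒P f≈g = contradiction (P⇒Q p) ¬q
  when-cong (no ¬p) (yes q) P⇒Q Q⇒P f≈g = contradiction (Q⇒P q) ¬p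
  when-cong (no ¬p) (no ¬q) P⇒Q Q⇒P f≈g = ≈-refl

  -- Serves two purposes: exchanging decisions of equivalent conditions, such as `suc l <? suc j`
  -- for `l <? j` when an induction shifts indices, and rewriting summands that depend on the proof
  -- of the condition. Agreement is asked for every pair of proofs because the ones produced by `P?`
  -- and `Q?` are not under control.
  ∑where-cong : ∀ {n} {P : Pred (Fin n) p} {Q : Pred (Fin n) q} (P? : Decidable P) (Q? : Decidable Q)
                {f : ∀ i → P i → Carrier} {g : ∀ i → Q i → Carrier} →
                (∀ {i} → P i → Q i) → (∀ {i} → Q i → P i) → (∀ i p q → f i p ≈ g i q) →
                ∑where M P? f ≈ ∑where M Q? g
  ∑where-cong P? Q? P⇒Q Q⇒P f≈g =
    FiniteSum.sum-cong-≋ M (λ i → when-cong (P? i) (Q? i) P⇒Q Q⇒P (f≈g i))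

-- The proof handed to `f` is the one found by `P?`, not the given one, so the value `x` must be the
-- same for all proofs.
when-yes : ∀ {p} {P : Set p} (P? : Dec P) (f : P → ℤ) {x} → P → (∀ p → f p ≡ x) →
           when +-0-commutativeMonoid P? f ≡ x
when-yes (yes p) f _ f≡x = f≡x p
when-yes (no ¬p) f p _   = contradiction p ¬p

when-no : ∀ {p} {P : Set p} (P? : Dec P) (f : P → ℤ) → ¬ P →
          when +-0-commutativeMonoid P? f ≡ 0ℤ
when-no (yes p) f ¬p = contradiction p ¬p
when-no (no _)  f _  = refl

module _ {n p} {P : Pred (Fin n) p} (P? : Decidable P) (f : ∀ i → P i → ℤ) where

  ∑where-universal : (∀ i → P i) → {g : Fin n → ℤ} → (∀ i p → f i p ≡ g i) →
                     ∑where +-0-commutativeMonoid P? f ≡ sum g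
  ∑where-universal all f≡g = sum-cong-≋ λ i → when-yes (P? i) (f i) (all i) (f≡g i)

  ∑where-empty : (∀ i → ¬ P i) → ∑where +-0-commutativeMonoid P? f ≡ 0ℤ
  ∑where-empty none = trans (sum-cong-≋ λ i → when-no (P? i) (f i) (none i)) (sum-replicate-zero n)

module _ {n p} {P : Pred (Fin (suc n)) p} (P? : Decidable P) (f : ∀ i → P i → ℤ) where

  ∑where-tail : ℤ
  ∑where-tail = ∑where +-0-commutativeMonoid (λ i → P? (suc i)) (λ i → f (suc i))

  ∑where-∷-yes : ∀ {x} → P zero → (∀ p → f zero p ≡ x) →
                 ∑where +-0-commutativeMonoid P? f ≡ x + ∑where-tail
  ∑where-∷-yes p f≡x = cong (λ x → x + ∑where-tail) (when-yes (P? zero) (f zero) p f≡x)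

  ∑where-∷-no : ¬ P zero → ∑where +-0-commutativeMonoid P? f ≡ ∑where-tail
  ∑where-∷-no ¬p = trans (cong (λ x → x + ∑where-tail) (when-no (P? zero) (f zero) ¬p)) (+-identityˡ _)

[a-b]+[b-c]≡a-c : ∀ a b c → (a - b) + (b - c) ≡ a - c
[a-b]+[b-c]≡a-c = solve-∀

[b-a]+[c-b]≡c-a : ∀ a b c → (b - a) + (c - b) ≡ c - a
[b-a]+[c-b]≡c-a = solve-∀

[a-b]-[c-d]≡[a-c]-[b-d] : ∀ a b c d → (a - b) - (c - d) ≡ (a - c) - (b - d)
[a-b]-[c-d]≡[a-c]-[b-d] = solve-∀

a≡[a-b]+b : ∀ a b → a ≡ (a - b) + b
a≡[a-b]+b = solve-∀

sum-telescope : ∀ {m} (h : Fin (suc m) → ℤ) →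
                sum (λ j → h (inject₁ j) - h (suc j)) ≡ h zero - h (fromℕ m)
-- The sum is empty, and `fromℕ zero` is `zero`, so both terms on the right coincide.
sum-telescope {zero}  h = sym (+-inverseʳ (h zero))
sum-telescope {suc m} h =
  trans (cong (_+_ (h zero - h (suc zero))) (sum-telescope (λ j → h (suc j))))
        ([a-b]+[b-c]≡a-c (h zero) (h (suc zero)) (h (fromℕ (suc m))))

-- By induction on `l`. At `zero` only index 0 is excluded, so what remains is an unrestricted sum
-- and `sum-telescope` applies; at `suc l`, index 0 drops out and everything shifts down by one. `h`
-- takes a proof of `l ≤ᶠ j` because Betti numbers exist only for ordered pairs of indices.
∑where-telescope-> :
  ∀ {m} (l : Fin (suc m)) (h : ∀ j → l ≤ᶠ j → ℤ) (f : ∀ j → l <ᶠ j → ℤ) →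
  (∀ j l<1+j l≤j l≤1+j → f (suc j) l<1+j ≡ h (inject₁ j) l≤j - h (suc j) l≤1+j) →
  ∑where +-0-commutativeMonoid (l <?_) f ≡ h l ≤-refl - h (fromℕ m) (≤fromℕ l)
∑where-telescope-> {m} zero h f step = begin
  ∑where +-0-commutativeMonoid (zero {m} <?_) f
    ≡⟨ ∑where-∷-no (zero {m} <?_) f (λ ()) ⟩
  ∑where +-0-commutativeMonoid (λ (j : Fin m) → zero {m} <? suc j) (λ j → f (suc j))
    ≡⟨ ∑where-universal (λ (j : Fin m) → zero {m} <? suc j) (λ j → f (suc j)) (λ _ → s≤s z≤n)
         (λ j l<1+j → step j l<1+j z≤n z≤n) ⟩
  sum (λ j → h (inject₁ j) z≤n - h (suc j) z≤n)
    ≡⟨ sum-telescope (λ j → h j z≤n) ⟩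
  h zero z≤n - h (fromℕ m) z≤n
    ≡⟨ cong (λ p → h zero z≤n - h (fromℕ m) p) (≤-irrelevant z≤n (≤fromℕ {m} zero)) ⟩
  h zero z≤n - h (fromℕ m) (≤fromℕ {m} zero) ∎
  where open ≡-Reasoning
∑where-telescope-> {suc m} (suc l) h f step = begin
  ∑where +-0-commutativeMonoid (suc l <?_) f
    ≡⟨ ∑where-∷-no (suc l <?_) f (λ ()) ⟩
  ∑where +-0-commutativeMonoid (λ j → suc l <? suc j) (λ j → f (suc j))
    ≡⟨ ∑where-cong +-0-commutativeMonoid (λ j → suc l <? suc j) (l <?_) s≤s⁻¹ s≤s
         (λ j p q → cong (f (suc j)) (≤-irrelevant p (s≤s q))) ⟩
  ∑where +-0-commutativeMonoid (l <?_) (λ j l<j → f (suc j) (s≤s l<j))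
    ≡⟨ ∑where-telescope-> l (λ j l≤j → h (suc j) (s≤s l≤j)) (λ j l<j → f (suc j) (s≤s l<j))
         (λ j p q r → step (suc j) (s≤s p) (s≤s q) (s≤s r)) ⟩
  h (suc l) (s≤s ≤-refl) - h (suc (fromℕ m)) (s≤s (≤fromℕ l))
    ≡⟨ cong (λ p → h (suc l) (s≤s ≤-refl) - h (suc (fromℕ m)) p)
         (≤-irrelevant (s≤s (≤fromℕ l)) (≤fromℕ (suc l))) ⟩
  h (suc l) (s≤s ≤-refl) - h (suc (fromℕ m)) (≤fromℕ (suc l)) ∎
  where open ≡-Reasoning

-- Here `h₋₁ i` stands for `h (i - 1)`; it is a separate function so that it also has a value at 0,
-- where there is no predecessor. The induction on `k` splits off the term at 0, and the remaining
-- terms telescope down to `h₋₁ 1`, which is `h 0`.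
∑where-telescope-≤ :
  ∀ {m} (k : Fin (suc m)) (h h₋₁ : ∀ i → i ≤ᶠ k → ℤ) →
  (∀ i 1+i≤k i≤k → h₋₁ (suc i) 1+i≤k ≡ h (inject₁ i) i≤k) →
  ∑where +-0-commutativeMonoid (_≤? k) (λ i i≤k → h i i≤k - h₋₁ i i≤k) ≡ h k ≤-refl - h₋₁ zero z≤n
∑where-telescope-≤ {m} zero h h₋₁ step = begin
  ∑where +-0-commutativeMonoid (_≤? zero {m}) f
    ≡⟨ ∑where-∷-yes (_≤? zero {m}) f z≤n (λ { z≤n → refl }) ⟩
  f zero z≤n + ∑where +-0-commutativeMonoid (λ i → suc i ≤? zero {m}) (λ i → f (suc i))
    -- No successor is at most 0, so only the term at index 0 survives.
    ≡⟨ cong (_+_ (f zero z≤n)) (∑where-empty (λ i → suc i ≤? zero {m}) (λ i → f (suc i)) (λ _ ())) ⟩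
  f zero z≤n + 0ℤ
    ≡⟨ +-identityʳ _ ⟩
  f zero z≤n ∎
  where
  open ≡-Reasoning
  f : ∀ i → i ≤ᶠ zero {m} → ℤ
  f i i≤k = h i i≤k - h₋₁ i i≤k
∑where-telescope-≤ {suc m} (suc k) h h₋₁ step = begin
  ∑where +-0-commutativeMonoid (_≤? suc k) f
    ≡⟨ ∑where-∷-yes (_≤? suc k) f z≤n (λ { z≤n → refl }) ⟩
  f zero z≤n + ∑where +-0-commutativeMonoid (λ i → suc i ≤? suc k) (λ i → f (suc i))
    ≡⟨ cong (_+_ (f zero z≤n)) (∑where-cong +-0-commutativeMonoid (λ i → suc i ≤? suc k) (_≤? k)
         s≤s⁻¹ s≤s (λ i p q → cong (f (suc i)) (≤-irrelevant p (s≤s q)))) ⟩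
  f zero z≤n + ∑where +-0-commutativeMonoid (_≤? k) (λ i i≤k → f (suc i) (s≤s i≤k))
    ≡⟨ cong (_+_ (f zero z≤n)) (∑where-telescope-≤ k
         (λ i p → h (suc i) (s≤s p)) (λ i p → h₋₁ (suc i) (s≤s p))
         (λ i p q → step (suc i) (s≤s p) (s≤s q))) ⟩
  f zero z≤n + (h (suc k) (s≤s ≤-refl) - h₋₁ (suc zero) (s≤s z≤n))
    -- The lower end of the shifted sum meets the term split off at 0.
    ≡⟨ cong (λ x → f zero z≤n + (h (suc k) (s≤s ≤-refl) - x)) (step zero (s≤s z≤n) z≤n) ⟩
  f zero z≤n + (h (suc k) (s≤s ≤-refl) - h zero z≤n)
    ≡⟨ [b-a]+[c-b]≡c-a (h₋₁ zero z≤n) (h zero z≤n) (h (suc k) (s≤s ≤-refl)) ⟩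
  h (suc k) (s≤s ≤-refl) - h₋₁ zero z≤n ∎
  where
  open ≡-Reasoning
  f : ∀ i → i ≤ᶠ suc k → ℤ
  f i i≤k = h i i≤k - h₋₁ i i≤k

module _ {m} {i : Fin (suc m)} {j : Fin m} (i<1+j : i <ᶠ suc j) where

  -- The same term as `j≤p` inside `μ`, so that `ν-suc` below can be met by `refl`; `suc≤⇒inject₁≤`
  -- likewise copies the proof inside `β₋₁`, for `b₋₁-suc`.
  <suc⇒≤inject₁ : i ≤ᶠ inject₁ j
  <suc⇒≤inject₁ = subst (toℕ i ℕ.≤_) (sym (toℕ-inject₁ j)) (s≤s⁻¹ i<1+j)

module _ {m} {i : Fin m} {j : Fin (suc m)} (1+i≤j : suc i ≤ᶠ j) where

  suc≤⇒inject₁≤ : inject₁ i ≤ᶠ j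
  suc≤⇒inject₁≤ = <⇒≤ (subst (ℕ._< toℕ j) (sym (toℕ-inject₁ i)) 1+i≤j)

-- Agda cannot recover the proof of i ≤ j from a Betti number, which unfolds, but it can from b i j _
-- for a variable b.
module _ {m} (b b₋₁ : ∀ (i j : Fin (suc m)) → i ≤ᶠ j → ℤ) (ν : ∀ (i j : Fin (suc m)) → i <ᶠ j → ℤ)
  (b₋₁-zero : ∀ j 0≤j → b₋₁ zero j 0≤j ≡ 0ℤ)
  (b₋₁-suc : ∀ i j 1+i≤j → b₋₁ (suc i) j 1+i≤j ≡ b (inject₁ i) j (suc≤⇒inject₁≤ 1+i≤j))
  (ν-suc : ∀ i j i<1+j → ν i (suc j) i<1+j ≡
    (b   i (inject₁ j) (<suc⇒≤inject₁ i<1+j) - b   i (suc j) (<⇒≤ i<1+j)) -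
    (b₋₁ i (inject₁ j) (<suc⇒≤inject₁ i<1+j) - b₋₁ i (suc j) (<⇒≤ i<1+j))) where

  private
    b-irr : ∀ {i j p q} → b i j p ≡ b i j q
    b-irr {i} {j} {p} {q} = cong (b i j) (≤-irrelevant p q)

    b₋₁-irr : ∀ {i j p q} → b₋₁ i j p ≡ b₋₁ i j q
    b₋₁-irr {i} {j} {p} {q} = cong (b₋₁ i j) (≤-irrelevant p q)

  -- `ν-suc` groups the four terms by row, while telescoping in `j` needs them grouped by column.
  -- Exchanging the two middle terms turns each summand into a difference of consecutive values of
  -- `b-b₋₁`; the same exchange afterwards restores the rows for the sum over `i`.
  ∑ν-row : ∀ (i l : Fin (suc m)) (i≤l : i ≤ᶠ l) →
           ∑where +-0-commutativeMonoid (l <?_) (λ j l<j → ν i j (≤-<-trans i≤l l<j)) ≡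
           (b i l i≤l - b i (fromℕ m) (≤fromℕ i)) - (b₋₁ i l i≤l - b₋₁ i (fromℕ m) (≤fromℕ i))
  ∑ν-row i l i≤l = begin
    ∑where +-0-commutativeMonoid (l <?_) (λ j l<j → ν i j (≤-<-trans i≤l l<j))
      ≡⟨ ∑where-telescope-> l b-b₋₁ (λ j l<j → ν i j (≤-<-trans i≤l l<j)) (λ j _ _ _ →
           trans (ν-suc i j _) (trans
             ([a-b]-[c-d]≡[a-c]-[b-d] (b i (inject₁ j) _) (b i (suc j) _)
               (b₋₁ i (inject₁ j) _) (b₋₁ i (suc j) _))
             (cong₂ _-_ (cong₂ _-_ b-irr b₋₁-irr) (cong₂ _-_ b-irr b₋₁-irr)))) ⟩
    b-b₋₁ l ≤-refl - b-b₋₁ (fromℕ m) (≤fromℕ l)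
      ≡⟨ cong₂ _-_ (cong₂ _-_ b-irr b₋₁-irr) (cong₂ _-_ b-irr b₋₁-irr) ⟩
    (b i l i≤l - b₋₁ i l i≤l) - (b i (fromℕ m) (≤fromℕ i) - b₋₁ i (fromℕ m) (≤fromℕ i))
      ≡⟨ [a-b]-[c-d]≡[a-c]-[b-d] (b i l i≤l) (b₋₁ i l i≤l)
           (b i (fromℕ m) (≤fromℕ i)) (b₋₁ i (fromℕ m) (≤fromℕ i)) ⟩
    (b i l i≤l - b i (fromℕ m) (≤fromℕ i)) - (b₋₁ i l i≤l - b₋₁ i (fromℕ m) (≤fromℕ i)) ∎
    where
    open ≡-Reasoning
    b-b₋₁ : ∀ j → l ≤ᶠ j → ℤ
    b-b₋₁ j l≤j = b i j (≤-trans i≤l l≤j) - b₋₁ i j (≤-trans i≤l l≤j)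

  -- Each row sum is `δ i - δ₋₁ i`, and `δ₋₁` is `δ` moved by one row because `b₋₁` is `b` moved by
  -- one row, so the sum over `i` telescopes too.
  ∑∑ν : ∀ (k l : Fin (suc m)) (k≤l : k ≤ᶠ l) →
        ∑where +-0-commutativeMonoid (_≤? k) (λ i i≤k →
          ∑where +-0-commutativeMonoid (l <?_) (λ j l<j → ν i j (≤-<-trans (≤-trans i≤k k≤l) l<j))) ≡
        b k l k≤l - b k (fromℕ m) (≤fromℕ k)
  ∑∑ν k l k≤l = begin
    ∑where +-0-commutativeMonoid (_≤? k) (λ i i≤k →
      ∑where +-0-commutativeMonoid (l <?_) (λ j l<j → ν i j (≤-<-trans (≤-trans i≤k k≤l) l<j)))
      ≡⟨ ∑where-cong +-0-commutativeMonoid (_≤? k) (_≤? k) id id (λ i p q →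
           trans (∑ν-row i l (≤-trans p k≤l))
                 (cong (λ p → δ i p - δ₋₁ i p) (≤-irrelevant p q))) ⟩
    ∑where +-0-commutativeMonoid (_≤? k) (λ i i≤k → δ i i≤k - δ₋₁ i i≤k)
      ≡⟨ ∑where-telescope-≤ k δ δ₋₁ (λ i _ _ →
           cong₂ _-_ (trans (b₋₁-suc i l _) b-irr) (trans (b₋₁-suc i (fromℕ m) _) b-irr)) ⟩
    δ k ≤-refl - δ₋₁ zero z≤n
      -- The convention for row -1 makes both terms of `δ₋₁ zero` vanish, and `0ℤ - 0ℤ` computes to
      -- `0ℤ`.
      ≡⟨ cong₂ _-_ (cong₂ _-_ b-irr refl) (cong₂ _-_ (b₋₁-zero l _) (b₋₁-zero (fromℕ m) _)) ⟩
    (b k l k≤l - b k (fromℕ m) (≤fromℕ k)) - 0ℤ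
      ≡⟨ +-identityʳ _ ⟩
    b k l k≤l - b k (fromℕ m) (≤fromℕ k) ∎
    where
    open ≡-Reasoning
    δ δ₋₁ : ∀ i → i ≤ᶠ k → ℤ
    δ   i i≤k = b   i l (≤-trans i≤k k≤l) - b   i (fromℕ m) (≤fromℕ i)
    δ₋₁ i i≤k = b₋₁ i l (≤-trans i≤k k≤l) - b₋₁ i (fromℕ m) (≤fromℕ i)

theorem8 : ∀ {N m : ℕ} {𝒦 : SimplicialComplex N} (F : Filtration 𝒦 m) →
    ∀ (n : ℤ) (k l : Fin (suc m)) (k≤l : k ≤ᶠ l) →
    + β F n k l k≤l ≡
      ∑where +-0-commutativeMonoid (_≤? k) (λ i i≤k →
        ∑where +-0-commutativeMonoid (l <?_) (λ j l<j →
          μ F n i j (≤-<-trans (≤-trans i≤k k≤l) l<j)))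
      + + β F n k (fromℕ m) (≤fromℕ k)
theorem8 {m = m} F n k l k≤l = begin
  + β F n k l k≤l
    ≡⟨ a≡[a-b]+b (+ β F n k l k≤l) (+ β F n k (fromℕ m) (≤fromℕ k)) ⟩
  (+ β F n k l k≤l - + β F n k (fromℕ m) (≤fromℕ k)) + + β F n k (fromℕ m) (≤fromℕ k)
    -- The three hypotheses on `b`, `b₋₁` and `ν` are the defining equations of `β₋₁` and `μ`.
    ≡⟨ cong (λ x → x + + β F n k (fromℕ m) (≤fromℕ k))
         (∑∑ν (λ i j i≤j → + β F n i j i≤j) (λ i j i≤j → + β₋₁ F n i j i≤j) (μ F n)
           (λ _ _ → refl) (λ _ _ _ → refl) (λ _ _ _ → refl) k l k≤l) ⟨
  _ ∎
  where open ≡-Reasoning
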